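{- Let the sequence $(b_0,b_1,\ldots)$ be defined by $b_0:=0$ and $b_k:=E_{k-1}(1)$ for $k\ge1$, where $E_j(x)$ are the Euler polynomials. Then for all $n\ge1$, $$H_n(b_k)=(-1)^{n-1}\frac{2^{n+1}}{n!}\cdot\mathcal{H}_{1,n}^{ - }\cdot H_n\big(E_k(1)\big),\qquad\text{where}\quad \mathcal{H}_{1,n}^{ - }:=\sum_{j=1}^n\frac{(-1)^{j-1}}{j}.$$
   Context: For a sequence $(a_k)_{k\ge 0}$ and $n\ge 0$, $H_n(a_k):=\det(a_{i+j})_{0\le i,j\le n}$ denotes the $(n+1)\times(n+1)$ Hankel determinant. The Euler polynomials are defined by $\frac{2e^{xt}}{e^t+1}=\sum_{n\ge0}E_n(x)\frac{t^n}{n!}$. -}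

module Defs where

open import Data.Nat.Base as ℕ using (ℕ; zero; suc; _∸_; _!)
open import Data.Nat.Properties as ℕ using (_!≢0)
open import Data.Fin.Base using (Fin; zero; suc; toℕ; punchIn)
open import Data.Integer.Base as ℤ using (ℤ; +_)
import Data.Integer.Properties as ℤ
open import Data.Rational.Base
open import Data.Rational.Properties
open import Data.Rational.Unnormalised.Base as ℚᵘ using (mkℚᵘ; *≡*)
import Data.Rational.Unnormalised.Properties as ℚᵘ
open import Data.Vec.Base using (Vec; []; _∷_; head; lookup)
open import Algebra.Bundles using (CommutativeRing)
open import Algebra.Definitions.RawSemiring +-*-rawSemiring public using (sum; _^_)
open import Algebra.Properties.Monoid.Sum
  (CommutativeRing.+-monoid +-*-commutativeRing) using (sum-cong-≗)
open import Relation.Binary.PropositionalEquality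

infixl 7 _/!_

_/!_ : ℤ → ℕ → ℚ
p /! n = (p / n !) {{n !≢0}}

-- Formal power series in t, given by their coefficients.
Series : Set
Series = ℕ → ℚ

infixl 6 _⊕_
infixl 7 _⊗_

_⊕_ _⊗_ : Series → Series → Series
(f ⊕ g) n = f n + g n
(f ⊗ g) n = sum {suc n} (λ i → f (toℕ i) * g (n ∸ toℕ i))

constant : ℚ → Series
constant c zero    = c
constant c (suc _) = 0ℚ

-- The quotient of power series f / g for g 0 ≠ 0. Its coefficients c are determined by
-- f n = g 0 * c n + Σ_{i<n} g (i+1) * c (n-1-i).
module Quotient (f g : Series) .{{_ : NonZero (g 0)}} where

  nextCoeff : ∀ n → Vec ℚ n → ℚ
  nextCoeff n cs = (f n - sum {n} (λ i → g (suc (toℕ i)) * lookup cs i)) ÷ g 0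

  -- Latest coefficient first: c (n-1) ∷ … ∷ c 0 ∷ [].
  coeffs : ∀ n → Vec ℚ n
  coeffs zero    = []
  coeffs (suc n) = nextCoeff n (coeffs n) ∷ coeffs n

  quotient : Series
  quotient n = head (coeffs (suc n))

  lookup-coeffs : ∀ n (i : Fin n) → lookup (coeffs n) i ≡ quotient (n ∸ suc (toℕ i))
  lookup-coeffs (suc n) zero    = refl
  lookup-coeffs (suc n) (suc i) = lookup-coeffs n i

  ⊗-quotient : ∀ n → (g ⊗ quotient) n ≡ f n
  ⊗-quotient n = begin
    g 0 * (d ÷ g 0) + sum {n} (λ i → g (suc (toℕ i)) * quotient (n ∸ suc (toℕ i)))
      ≡⟨ cong₂ _+_ cancel
           (sum-cong-≗ {n} (λ i → cong (g (suc (toℕ i)) *_) (sym (lookup-coeffs n i)))) ⟩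
    (f n - s) + s    ≡⟨ +-assoc (f n) (- s) s ⟩
    f n + (- s + s)  ≡⟨ cong (λ z → f n + z) (+-inverseˡ s) ⟩
    f n + 0ℚ         ≡⟨ +-identityʳ (f n) ⟩
    f n              ∎
    where
    open ≡-Reasoning
    s d : ℚ
    s = sum {n} (λ i → g (suc (toℕ i)) * lookup (coeffs n) i)
    d = f n - s
    cancel : g 0 * (d ÷ g 0) ≡ d
    cancel = begin
      g 0 * (d * 1/ g 0)  ≡⟨ *-comm (g 0) _ ⟩
      d * 1/ g 0 * g 0    ≡⟨ *-assoc d _ _ ⟩
      d * (1/ g 0 * g 0)  ≡⟨ cong (d *_) (*-inverseˡ (g 0)) ⟩
      d * 1ℚ              ≡⟨ *-identityʳ d ⟩
      d                   ∎

-- The series of e^{xt}.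
exp[_t] : ℚ → Series
exp[ x t] n = x ^ n * (+ 1 /! n)

2exp[_t] : ℚ → Series
2exp[ x t] n = (+ 2 / 1) * exp[ x t] n

expt+1 : Series
expt+1 = exp[ 1ℚ t] ⊕ constant 1ℚ

-- E n x is the value of the n-th Euler polynomial at x ∈ ℚ, that is, n! times the
-- coefficient of tⁿ in 2e^{xt} / (e^t + 1).
E : ℕ → ℚ → ℚ
E n x = (+ (n !) / 1) * Quotient.quotient 2exp[ x t] expt+1 n

private
  n!*1/n! : ∀ n → (+ (n !) / 1) * (+ 1 /! n) ≡ 1ℚ
  n!*1/n! n = go (n !) {{n !≢0}}
    where
    go : ∀ m .{{_ : ℕ.NonZero m}} → (+ m / 1) * (+ 1 / m) ≡ 1ℚ
    go m@(suc m-1) = trans (sym (fromℚᵘ-homo (mkℚᵘ (+ m) 0) (mkℚᵘ (+ 1) m-1)))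
      (fromℚᵘ-cong {mkℚᵘ (+ m) 0 ℚᵘ.* mkℚᵘ (+ 1) m-1} {ℚᵘ.1ℚᵘ} (*≡* eq))
      where
      fromℚᵘ-homo : ∀ p q → fromℚᵘ (p ℚᵘ.* q) ≡ fromℚᵘ p * fromℚᵘ q
      fromℚᵘ-homo p q = toℚᵘ-injective (ℚᵘ.≃-trans (toℚᵘ-fromℚᵘ (p ℚᵘ.* q))
        (ℚᵘ.≃-trans (ℚᵘ.*-cong (ℚᵘ.≃-sym (toℚᵘ-fromℚᵘ p)) (ℚᵘ.≃-sym (toℚᵘ-fromℚᵘ q)))
          (ℚᵘ.≃-sym (toℚᵘ-homo-* (fromℚᵘ p) (fromℚᵘ q)))))
      eq : + m ℤ.* + 1 ℤ.* + 1 ≡ + 1 ℤ.* (+ 1 ℤ.* + m)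
      eq = trans (cong (ℤ._* + 1) (ℤ.*-identityʳ (+ m)))
        (trans (ℤ.*-comm (+ m) (+ 1)) (cong (+ 1 ℤ.*_) (sym (ℤ.*-identityˡ (+ m)))))

-- The defining identity, as power series in t: (e^t + 1) Σ E_n(x) tⁿ/n! = 2e^{xt}.
E-generating : ∀ x n → (expt+1 ⊗ (λ k → E k x * (+ 1 /! k))) n ≡ 2exp[ x t] n
E-generating x n = trans
  (sum-cong-≗ {suc n} (λ i → cong (expt+1 (toℕ i) *_) (coeff (n ∸ toℕ i))))
  (⊗-quotient n)
  where
  open Quotient 2exp[ x t] expt+1
  open ≡-Reasoning
  coeff : ∀ k → E k x * (+ 1 /! k) ≡ quotient k
  coeff k = begin
    (+ (k !) / 1) * quotient k * (+ 1 /! k)    ≡⟨ cong (_* (+ 1 /! k)) (*-comm (+ (k !) / 1) (quotient k)) ⟩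
    quotient k * (+ (k !) / 1) * (+ 1 /! k)    ≡⟨ *-assoc (quotient k) _ _ ⟩
    quotient k * ((+ (k !) / 1) * (+ 1 /! k))  ≡⟨ cong (quotient k *_) (n!*1/n! k) ⟩
    quotient k * 1ℚ                            ≡⟨ *-identityʳ (quotient k) ⟩
    quotient k                                 ∎

-- Laplace expansion along row zero; punchIn j skips column j.
det : ∀ {n} → (Fin n → Fin n → ℚ) → ℚ
det {zero}  A = 1ℚ
det {suc n} A =
  sum {suc n} (λ j → (- 1ℚ) ^ toℕ j * A zero j * det (λ r c → A (suc r) (punchIn j c)))

-- The Hankel determinant of size n + 1.
H : ℕ → (ℕ → ℚ) → ℚ
H n a = det {suc n} (λ i j → a (toℕ i ℕ.+ toℕ j))

-- Σ_{j=1}^n (-1)^{j-1} / j, with i = j - 1.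
ℋ⁻₁ : ℕ → ℚ
ℋ⁻₁ n = sum {n} (λ i → (- 1ℚ) ^ toℕ i * (+ 1 / suc (toℕ i)))

b : ℕ → ℚ
b zero    = 0ℚ
b (suc k) = E k 1ℚ

{-# OPTIONS --safe #-}
-- Let L and B be the functionals with L (xᵏ) = Eₖ(1) and B (xᵏ) = bₖ, so that B (x p) = L (p), and
-- let P₀, P₁, … be the monic orthogonal polynomials of L. In terms of w = (1 - e^t) / (1 + e^t) the
-- exponential generating function of k ↦ L (xᵏ Pₙ) is n!/2ⁿ (1 - w) wⁿ, which vanishes to order n;
-- since w′ = (w² - 1) / 2 this gives Pₙ₊₁ = (x - ½) Pₙ + (n/2)² Pₙ₋₁. Column operations
-- turn the Hankel matrix of L into the lower triangular (L (xⁱ Pⱼ)), and that of B into (B (xⁱ Pⱼ)),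
-- which below its first row is again (L (xⁱ Pⱼ)). Hence Hₙ(b) / Hₙ(E(1)) = (-1)ⁿ B (Pₙ) / L (xⁿ Pₙ),
-- and B (Pₙ) = -2 (-1)ⁿ n!/2ⁿ Σ_{j=1}^n (-1)^{j-1}/j solves the recurrence of the Pₙ.
module Submission where

open import Defs
open import Data.Fin.Base as Fin using (Fin; zero; suc; toℕ; fromℕ; fromℕ<; inject₁; punchIn; punchOut)
open import Data.Fin.Induction using (<-weakInduction)
import Data.Fin.Properties as Fin
open import Data.Integer.Base as ℤ using (+_)
import Data.Integer.Properties as ℤ
open import Data.Nat.Base as ℕ using (ℕ; zero; suc; z≤n; s≤s; _∸_; _!)
open import Data.Nat.Induction using (<-rec)
import Data.Nat.Properties as ℕ
open import Data.Product.Base using (∃; _,_; _×_)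
open import Data.Rational.Base using (ℚ; 0ℚ; 1ℚ; ½; _+_; _*_; _-_; -_; _/_; fromℚᵘ)
open import Data.Rational.Properties as ℚ using (+-*-commutativeRing; *-1-commutativeMonoid)
open import Data.Rational.Solver using (module +-*-Solver)
open import Data.Rational.Unnormalised.Base as ℚᵘ using (mkℚᵘ; *≡*)
import Data.Rational.Unnormalised.Properties as ℚᵘ
open import Data.Sum.Base using (_⊎_; inj₁; inj₂)
open import Data.Vec.Functional using (updateAt)
open import Data.Vec.Functional.Properties using (updateAt-updates; updateAt-minimal)
open import Algebra.Bundles using (CommutativeRing)
open import Algebra.Properties.CommutativeMonoid.Sum *-1-commutativeMonoid
  using () renaming (sum to product; sum-cong-≗ to product-cong; sum-init-last to product-init-last)
open import Algebra.Properties.Group ℚ.+-0-group using () renaming (∙-cancelʳ to +-cancelʳ)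
open import Algebra.Properties.Semiring.Sum (CommutativeRing.semiring +-*-commutativeRing)
  using (sum-cong-≗; sum-init-last; ∑-distrib-+; *-distribˡ-sum; sum-replicate-zero)
open import Function.Base using (_∘_)
open import Relation.Nullary using (yes; no; contradiction)
open import Relation.Binary.PropositionalEquality
open +-*-Solver
open ≡-Reasoning

-- Determinants and column operations

Matrix : ℕ → Set
Matrix n = Fin n → Fin n → ℚ

sign : ∀ {n} → Fin n → ℚ
sign c = (- 1ℚ) ^ toℕ c

minor : ∀ {n} → Matrix (suc n) → Fin (suc n) → Matrix n
minor A j r c = A (suc r) (punchIn j c)

det-cong : ∀ {n} {A B : Matrix n} → (∀ r c → A r c ≡ B r c) → det A ≡ det B
det-cong {zero}  A≗B = refl
det-cong {suc n} A≗B = sum-cong-≗ {suc n} λ j →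
  cong₂ (λ x y → sign j * x * y) (A≗B zero j)
    (det-cong λ r c → A≗B (suc r) (punchIn j c))

-- Expand along row zero. The minor at column `k` omits that column, so only the entry there is a
-- combination. At any other `j` the entry is common and the minor is linear in column
-- `punchOut j≢k`, by induction.
det-linear : ∀ {n} (k : Fin n) {A B C : Matrix n} α β →
  (∀ r → A r k ≡ α * B r k + β * C r k) →
  (∀ r c → c ≢ k → A r c ≡ B r c) →
  (∀ r c → c ≢ k → A r c ≡ C r c) →
  det A ≡ α * det B + β * det C
det-linear {suc n} k {A} {B} {C} α β col A≗B A≗C = begin
  sum {suc n} (term A)
    ≡⟨ sum-cong-≗ {suc n} linear ⟩
  sum {suc n} (λ j → α * term B j + β * term C j)
    ≡⟨ ∑-distrib-+ {suc n} (λ j → α * term B j) (λ j → β * term C j) ⟩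
  sum {suc n} (λ j → α * term B j) + sum {suc n} (λ j → β * term C j)
    ≡⟨ sym (cong₂ _+_ (*-distribˡ-sum {suc n} α (term B)) (*-distribˡ-sum {suc n} β (term C))) ⟩
  α * det B + β * det C ∎
  where
  term : Matrix (suc n) → Fin (suc n) → ℚ
  term M j = sign j * M zero j * det (minor M j)

  linear : ∀ j → term A j ≡ α * term B j + β * term C j
  linear j with j Fin.≟ k
  ... | yes refl = begin
    sign j * A zero j * det (minor A j)
      ≡⟨ cong (λ x → sign j * x * det (minor A j)) (col zero) ⟩
    sign j * (α * B zero j + β * C zero j) * det (minor A j)
      ≡⟨ solve 6 (λ s a x b y d → s :* (a :* x :+ b :* y) :* d
           := a :* (s :* x :* d) :+ b :* (s :* y :* d)) refl (sign j) α (B zero j) β (C zero j) (det (minor A j)) ⟩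
    α * (sign j * B zero j * det (minor A j)) + β * (sign j * C zero j * det (minor A j))
      ≡⟨ cong₂ (λ x y → α * (sign j * B zero j * x) + β * (sign j * C zero j * y))
           (det-cong λ r c → A≗B (suc r) (punchIn j c) (Fin.punchInᵢ≢i j c))
           (det-cong λ r c → A≗C (suc r) (punchIn j c) (Fin.punchInᵢ≢i j c)) ⟩
    α * term B j + β * term C j ∎
  ... | no j≢k = begin
    sign j * A zero j * det (minor A j)
      ≡⟨ cong (sign j * A zero j *_) minors ⟩
    sign j * A zero j * (α * det (minor B j) + β * det (minor C j))
      ≡⟨ solve 6 (λ s x a d b e → s :* x :* (a :* d :+ b :* e)
           := a :* (s :* x :* d) :+ b :* (s :* x :* e)) refl
           (sign j) (A zero j) α (det (minor B j)) β (det (minor C j)) ⟩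
    α * (sign j * A zero j * det (minor B j)) + β * (sign j * A zero j * det (minor C j))
      ≡⟨ cong₂ (λ x y → α * (sign j * x * det (minor B j)) + β * (sign j * y * det (minor C j)))
           (A≗B zero j j≢k) (A≗C zero j j≢k) ⟩
    α * term B j + β * term C j ∎
    where
    k′ : Fin n
    k′ = punchOut j≢k

    k′-image : punchIn j k′ ≡ k
    k′-image = Fin.punchIn-punchOut j≢k

    avoid : ∀ c → c ≢ k′ → punchIn j c ≢ k
    avoid c c≢k′ eq = c≢k′ (Fin.punchIn-injective j c k′ (trans eq (sym k′-image)))

    minors : det (minor A j) ≡ α * det (minor B j) + β * det (minor C j)
    minors = det-linear k′ α β
      (λ r → subst (λ x → A (suc r) x ≡ α * B (suc r) x + β * C (suc r) x) (sym k′-image) (col (suc r)))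
      (λ r c c≢k′ → A≗B (suc r) (punchIn j c) (avoid c c≢k′))
      (λ r c c≢k′ → A≗C (suc r) (punchIn j c) (avoid c c≢k′))

-- The transposition of the columns inject₁ i and suc i.
swap : ∀ {n} → Fin n → Fin (suc n) → Fin (suc n)
swap zero    zero          = suc zero
swap zero    (suc zero)    = zero
swap zero    (suc (suc c)) = suc (suc c)
swap (suc i) zero          = zero
swap (suc i) (suc c)       = suc (swap i c)

swap-inject₁ : ∀ {n} (i : Fin n) → swap i (inject₁ i) ≡ suc i
swap-inject₁ zero    = refl
swap-inject₁ (suc i) = cong suc (swap-inject₁ i)

swap-suc : ∀ {n} (i : Fin n) → swap i (suc i) ≡ inject₁ i
swap-suc zero    = refl
swap-suc (suc i) = cong suc (swap-suc i)

swap-minimal : ∀ {n} (i : Fin n) c → c ≢ inject₁ i → c ≢ suc i → swap i c ≡ c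
swap-minimal zero    zero          c≢i c≢i+1 = contradiction refl c≢i
swap-minimal zero    (suc zero)    c≢i c≢i+1 = contradiction refl c≢i+1
swap-minimal zero    (suc (suc c)) c≢i c≢i+1 = refl
swap-minimal (suc i) zero          c≢i c≢i+1 = refl
swap-minimal (suc i) (suc c)       c≢i c≢i+1 =
  cong suc (swap-minimal i c (c≢i ∘ cong suc) (c≢i+1 ∘ cong suc))

sum-swap : ∀ {n} (i : Fin n) (f : Fin (suc n) → ℚ) → sum {suc n} (f ∘ swap i) ≡ sum {suc n} f
sum-swap {suc n} zero f =
  solve 3 (λ x y s → y :+ (x :+ s) := x :+ (y :+ s)) refl
    (f zero) (f (suc zero)) (sum {n} (λ c → f (suc (suc c))))
sum-swap (suc i) f = cong (λ z → f zero + z) (sum-swap i (f ∘ suc))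

-- If `c` is not transposed, deleting it leaves an adjacent transposition of the remaining columns.
-- If it is, deleting it from the swapped matrix leaves the minor at its partner with the columns in
-- order, and the sign flips because the two are neighbours.
swap-punchIn : ∀ {n} (i : Fin (suc n)) c →
  (swap i c ≡ c × ∃ λ i′ → ∀ x → swap i (punchIn c x) ≡ punchIn c (swap {n} i′ x)) ⊎
  (sign (swap i c) ≡ - 1ℚ * sign c × ∀ x → swap i (punchIn c x) ≡ punchIn (swap i c) x)
swap-punchIn zero zero = inj₂ (refl , λ { zero → refl ; (suc x) → refl })
swap-punchIn zero (suc zero) = inj₂ (refl , λ { zero → refl ; (suc x) → refl })
swap-punchIn {suc n} zero (suc (suc c)) =
  inj₁ (refl , zero , λ { zero → refl ; (suc zero) → refl ; (suc (suc x)) → refl })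
swap-punchIn {suc n} (suc i) zero = inj₁ (refl , i , λ x → refl)
swap-punchIn {suc n} (suc i) (suc c) with swap-punchIn i c
... | inj₁ (fix , i′ , comm) =
  inj₁ (cong suc fix , suc i′ , λ { zero → refl ; (suc x) → cong suc (comm x) })
... | inj₂ (flip , comm) =
  inj₂ (cong (- 1ℚ *_) flip , λ { zero → refl ; (suc x) → cong suc (comm x) })

-- The term at `c` becomes minus the term of `A` at `swap i c`: a fixed column gets the sign from
-- its minor by induction, a transposed one from its position.
det-swap : ∀ {n} (i : Fin n) (A : Matrix (suc n)) → det (λ r c → A r (swap i c)) ≡ - 1ℚ * det A
det-swap {suc n} i A = begin
  sum {2 ℕ.+ n} (λ c → sign c * A zero (swap i c) * det (minor A′ c))
    ≡⟨ sum-cong-≗ {2 ℕ.+ n} flip ⟩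
  sum {2 ℕ.+ n} (λ c → - 1ℚ * term (swap i c))
    ≡⟨ sym (*-distribˡ-sum {2 ℕ.+ n} (- 1ℚ) (term ∘ swap i)) ⟩
  - 1ℚ * sum {2 ℕ.+ n} (term ∘ swap i)
    ≡⟨ cong (- 1ℚ *_) (sum-swap i term) ⟩
  - 1ℚ * det A ∎
  where
  A′ : Matrix (2 ℕ.+ n)
  A′ r c = A r (swap i c)

  term : Fin (2 ℕ.+ n) → ℚ
  term c = sign c * A zero c * det (minor A c)

  flip : ∀ c → sign c * A zero (swap i c) * det (minor A′ c) ≡ - 1ℚ * term (swap i c)
  flip c with swap-punchIn i c
  ... | inj₁ (fix , i′ , comm) = begin
    sign c * A zero (swap i c) * det (minor A′ c)
      ≡⟨ cong₂ (λ x y → sign c * A zero x * y) fix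
           (trans (det-cong λ r x → cong (A (suc r)) (comm x)) (det-swap i′ (minor A c))) ⟩
    sign c * A zero c * (- 1ℚ * det (minor A c))
      ≡⟨ solve 4 (λ m s x d → s :* x :* (m :* d) := m :* (s :* x :* d)) refl
           (- 1ℚ) (sign c) (A zero c) (det (minor A c)) ⟩
    - 1ℚ * term c           ≡⟨ cong (λ x → - 1ℚ * term x) (sym fix) ⟩
    - 1ℚ * term (swap i c)  ∎
  ... | inj₂ (flip-sign , comm) = begin
    sign c * a * det (minor A′ c)
      ≡⟨ cong (sign c * a *_) (det-cong λ r x → cong (A (suc r)) (comm x)) ⟩
    sign c * a * d
      ≡⟨ solve 3 (λ s a d → s :* a :* d := con (- 1ℚ) :* (con (- 1ℚ) :* s :* a :* d)) refl (sign c) a d ⟩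
    - 1ℚ * (- 1ℚ * sign c * a * d)
      ≡⟨ cong (λ s → - 1ℚ * (s * a * d)) (sym flip-sign) ⟩
    - 1ℚ * term (swap i c) ∎
    where
    a d : ℚ
    a = A zero (swap i c)
    d = det (minor A (swap i c))

x≡-x⇒x≡0 : ∀ {x} → x ≡ - 1ℚ * x → x ≡ 0ℚ
x≡-x⇒x≡0 {x} eq = begin
  x                    ≡⟨ solve 1 (λ x → x := con ½ :* (x :+ x)) refl x ⟩
  ½ * (x + x)          ≡⟨ cong (λ y → ½ * (x + y)) eq ⟩
  ½ * (x + - 1ℚ * x)   ≡⟨ solve 1 (λ x → con ½ :* (x :+ con (- 1ℚ) :* x) := con 0ℚ) refl x ⟩
  0ℚ                   ∎

-- Induction on the right-hand column. If the equal columns are adjacent, swapping them fixes the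
-- matrix but negates the determinant; otherwise a swap brings the right one a step closer.
det-equalColumns : ∀ {n} (k : Fin n) (A : Matrix n) (i : Fin n) → i Fin.< k →
  (∀ r → A r i ≡ A r k) → det A ≡ 0ℚ
det-equalColumns {suc n} = <-weakInduction
  (λ k → ∀ A i → i Fin.< k → (∀ r → A r i ≡ A r k) → det A ≡ 0ℚ)
  (λ A i ()) step
  where
  step : ∀ (k : Fin n) →
    (∀ A i → i Fin.< inject₁ k → (∀ r → A r i ≡ A r (inject₁ k)) → det A ≡ 0ℚ) →
    ∀ A i → i Fin.< suc k → (∀ r → A r i ≡ A r (suc k)) → det A ≡ 0ℚ
  step k ih A i i<1+k eq with i Fin.≟ inject₁ k
  ... | yes refl = x≡-x⇒x≡0 (trans (det-cong unswapped) (det-swap k A))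
    where
    unswapped : ∀ r c → A r c ≡ A r (swap k c)
    unswapped r c with c Fin.≟ inject₁ k | c Fin.≟ suc k
    ... | yes refl | _        = trans (eq r) (cong (A r) (sym (swap-inject₁ k)))
    ... | no _     | yes refl = trans (sym (eq r)) (cong (A r) (sym (swap-suc k)))
    ... | no c≢k   | no c≢1+k = cong (A r) (sym (swap-minimal k c c≢k c≢1+k))
  ... | no i≢k = begin
    det A                                  ≡⟨ solve 1 (λ x → x := con (- 1ℚ) :* (con (- 1ℚ) :* x)) refl (det A) ⟩
    - 1ℚ * (- 1ℚ * det A)                  ≡⟨ cong (- 1ℚ *_) (sym (det-swap k A)) ⟩
    - 1ℚ * det (λ r c → A r (swap k c))    ≡⟨ cong (- 1ℚ *_) (ih (λ r c → A r (swap k c)) i i<k eq′) ⟩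
    0ℚ                                     ∎
    where
    i<k : i Fin.< inject₁ k
    i<k = Fin.≤∧≢⇒< (subst (toℕ i ℕ.≤_) (sym (Fin.toℕ-inject₁ k)) (ℕ.s≤s⁻¹ i<1+k)) i≢k

    eq′ : ∀ r → A r (swap k i) ≡ A r (swap k (inject₁ k))
    eq′ r = begin
      A r (swap k i)            ≡⟨ cong (A r) (swap-minimal k i i≢k (Fin.<⇒≢ i<1+k)) ⟩
      A r i                     ≡⟨ eq r ⟩
      A r (suc k)               ≡⟨ cong (A r) (sym (swap-inject₁ k)) ⟩
      A r (swap k (inject₁ k))  ∎

-- Unitriangular column operations and Hankel matrices

setColumn : ∀ {n} → Matrix n → Fin n → Series → Matrix n
setColumn A k v r = updateAt (A r) k (λ _ → v (toℕ r))

module _ {n} (A : Matrix n) (k : Fin n) (v : Series) where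

  setColumn-updates : ∀ r → setColumn A k v r k ≡ v (toℕ r)
  setColumn-updates r = updateAt-updates k (A r)

  setColumn-minimal : ∀ r c → c ≢ k → setColumn A k v r c ≡ A r c
  setColumn-minimal r c c≢k = updateAt-minimal c k (A r) c≢k

-- Membership is a tree of binary combinations rather than a list of coefficients, so that
-- `det-span` and `shift` can recurse on it.
data Span (e : ℕ → Series) (m : ℕ) : Series → Set where
  null      : ∀ {v} → (∀ r → v r ≡ 0ℚ) → Span e m v
  generator : ∀ {v} i → i ℕ.< m → (∀ r → v r ≡ e i r) → Span e m v
  combine   : ∀ {v w x} α β → Span e m v → Span e m w →
              (∀ r → x r ≡ α * v r + β * w r) → Span e m x

Span-weaken : ∀ {e m v} → Span e m v → Span e (suc m) v
Span-weaken (null v≡0)             = null v≡0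
Span-weaken (generator i i<m v≡e)  = generator i (ℕ.m<n⇒m<1+n i<m) v≡e
Span-weaken (combine α β v∈ w∈ x≡) = combine α β (Span-weaken v∈) (Span-weaken w∈) x≡

columns : ∀ n → (ℕ → Series) → Matrix n
columns n e r c = e (toℕ c) (toℕ r)

-- A generator repeats a column left of `k`, and combinations split by `det-linear`.
det-span : ∀ {n e v} (A : Matrix n) (k : Fin n) →
  (∀ r c → c Fin.< k → A r c ≡ e (toℕ c) (toℕ r)) → Span e (toℕ k) v →
  det (setColumn A k v) ≡ 0ℚ
det-span A k A≗e (null {v} v≡0) =
  trans (det-linear k {C = setColumn A k v} 0ℚ 0ℚ
    (λ r → trans (setColumn-updates A k v r) (trans (v≡0 (toℕ r))
      (solve 1 (λ x → con 0ℚ := con 0ℚ :* x :+ con 0ℚ :* x) refl (setColumn A k v r k))))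
    (λ r c _ → refl) (λ r c _ → refl))
    (solve 1 (λ x → con 0ℚ :* x :+ con 0ℚ :* x := con 0ℚ) refl (det (setColumn A k v)))
det-span {n} {e} A k A≗e (generator {v} i i<k v≡e) =
  det-equalColumns k (setColumn A k v) i′ i′<k λ r → begin
    setColumn A k v r i′      ≡⟨ setColumn-minimal A k v r i′ (Fin.<⇒≢ i′<k) ⟩
    A r i′                    ≡⟨ A≗e r i′ i′<k ⟩
    e (toℕ i′) (toℕ r)        ≡⟨ cong (λ j → e j (toℕ r)) (Fin.toℕ-fromℕ< i<n) ⟩
    e i (toℕ r)               ≡⟨ sym (v≡e (toℕ r)) ⟩
    v (toℕ r)                 ≡⟨ sym (setColumn-updates A k v r) ⟩
    setColumn A k v r k       ∎
  where
  i<n : i ℕ.< n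
  i<n = ℕ.<-trans i<k (Fin.toℕ<n k)

  i′ : Fin n
  i′ = fromℕ< i<n

  i′<k : i′ Fin.< k
  i′<k = subst (ℕ._< toℕ k) (sym (Fin.toℕ-fromℕ< i<n)) i<k
det-span A k A≗e (combine {v} {w} {x} α β v∈ w∈ x≡) = begin
  det (setColumn A k x)
    ≡⟨ det-linear k α β
         (λ r → trans (setColumn-updates A k x r) (trans (x≡ (toℕ r))
           (sym (cong₂ (λ y z → α * y + β * z) (setColumn-updates A k v r) (setColumn-updates A k w r)))))
         (λ r c c≢k → trans (setColumn-minimal A k x r c c≢k) (sym (setColumn-minimal A k v r c c≢k)))
         (λ r c c≢k → trans (setColumn-minimal A k x r c c≢k) (sym (setColumn-minimal A k w r c c≢k))) ⟩
  α * det (setColumn A k v) + β * det (setColumn A k w)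
    ≡⟨ cong₂ (λ y z → α * y + β * z) (det-span A k A≗e v∈) (det-span A k A≗e w∈) ⟩
  α * 0ℚ + β * 0ℚ
    ≡⟨ solve 2 (λ a b → a :* con 0ℚ :+ b :* con 0ℚ := con 0ℚ) refl α β ⟩
  0ℚ ∎

-- Each column changes by a combination of the columns of `e` to its left, which contributes zero by
-- `det-span`.
det-unitriangular : ∀ n (e f : ℕ → Series) → (∀ c → Span e c (λ r → f c r - e c r)) →
  det (columns n e) ≡ det (columns n f)
det-unitriangular n e f f-e∈ =
  go n ℕ.≤-refl (columns n e) (λ r c _ → refl)
    (λ r c n≤c → contradiction (Fin.toℕ<n c) (ℕ.≤⇒≯ n≤c))
  where
  -- The columns are replaced from the last to the first, so that those below the current one
  -- are still columns of e.
  go : ∀ m → m ℕ.≤ n → (M : Matrix n) →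
    (∀ r c → toℕ c ℕ.< m → M r c ≡ columns n e r c) →
    (∀ r c → m ℕ.≤ toℕ c → M r c ≡ columns n f r c) →
    det M ≡ det (columns n f)
  go zero    _   M M≗e M≗f = det-cong λ r c → M≗f r c z≤n
  go (suc m) m<n M M≗e M≗f = begin
    det M
      -- The added zero is the determinant with `f m - e m` in column `k`; linearity then merges
      -- both summands into the one with `f m`.
      ≡⟨ solve 1 (λ x → x := con 1ℚ :* x :+ con 1ℚ :* con 0ℚ) refl (det M) ⟩
    1ℚ * det M + 1ℚ * 0ℚ
      ≡⟨ cong (λ x → 1ℚ * det M + 1ℚ * x) (sym (det-span M k
           (λ r c c<k → M≗e r c (ℕ.<-trans (subst (toℕ c ℕ.<_) k≡m c<k) ℕ.≤-refl))
           (subst (λ j → Span e j d) (sym k≡m) (f-e∈ m)))) ⟩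
    1ℚ * det M + 1ℚ * det (setColumn M k d)
      ≡⟨ sym (det-linear k 1ℚ 1ℚ column
           (setColumn-minimal M k (f m))
           (λ r c c≢k → trans (setColumn-minimal M k (f m) r c c≢k) (sym (setColumn-minimal M k d r c c≢k)))) ⟩
    det M′             ≡⟨ go m (ℕ.<⇒≤ m<n) M′ M′≗e M′≗f ⟩
    det (columns n f)  ∎
    where
    k : Fin n
    k = fromℕ< m<n

    k≡m : toℕ k ≡ m
    k≡m = Fin.toℕ-fromℕ< m<n

    d : Series
    d r = f m r - e m r

    M′ : Matrix n
    M′ = setColumn M k (f m)

    column : ∀ r → M′ r k ≡ 1ℚ * M r k + 1ℚ * setColumn M k d r k
    column r = begin
      M′ r k           ≡⟨ setColumn-updates M k (f m) r ⟩
      f m (toℕ r)      ≡⟨ solve 2 (λ x y → x := con 1ℚ :* y :+ con 1ℚ :* (x :- y)) refl (f m (toℕ r)) (e m (toℕ r)) ⟩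
      1ℚ * e m (toℕ r) + 1ℚ * d (toℕ r)
        ≡⟨ cong₂ (λ x y → 1ℚ * x + 1ℚ * y)
             (sym (trans (M≗e r k (ℕ.≤-reflexive (cong suc k≡m))) (cong (λ j → e j (toℕ r)) k≡m)))
             (sym (setColumn-updates M k d r)) ⟩
      1ℚ * M r k + 1ℚ * setColumn M k d r k ∎

    M′≗e : ∀ r c → toℕ c ℕ.< m → M′ r c ≡ columns n e r c
    M′≗e r c c<m = trans
      (setColumn-minimal M k (f m) r c λ c≡k → ℕ.<⇒≢ c<m (trans (cong toℕ c≡k) k≡m))
      (M≗e r c (ℕ.m<n⇒m<1+n c<m))

    M′≗f : ∀ r c → m ℕ.≤ toℕ c → M′ r c ≡ columns n f r c
    M′≗f r c m≤c with c Fin.≟ k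
    ... | yes refl = trans (setColumn-updates M k (f m) r) (cong (λ j → f j (toℕ r)) (sym k≡m))
    ... | no c≢k   = trans (setColumn-minimal M k (f m) r c c≢k)
      (M≗f r c (ℕ.≤∧≢⇒< m≤c λ m≡c → c≢k (Fin.toℕ-injective (trans (sym m≡c) (sym k≡m)))))

-- If f n r = L (xʳ Pₙ) for monic polynomials with Pₙ₊₂ = (x + β (n + 1)) Pₙ₊₁ + γ n Pₙ, then column n
-- of the right-hand matrix is column n of the Hankel matrix plus a combination of earlier ones.
Hankel-recurrence : ∀ (f : ℕ → Series) (β γ : ℕ → ℚ) →
  (∀ r → f 1 r ≡ f 0 (suc r) + β 0 * f 0 r) →
  (∀ n r → f (2 ℕ.+ n) r ≡ f (1 ℕ.+ n) (suc r) + β (suc n) * f (1 ℕ.+ n) r + γ n * f n r) →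
  ∀ n → H n (f 0) ≡ det (columns (suc n) f)
Hankel-recurrence f β γ f₁ f₂₊ n = det-unitriangular (suc n) e f f-e∈
  where
  e : ℕ → Series
  e c r = f 0 (r ℕ.+ c)

  -- Shifting the row index is multiplication by x, which in a Hankel matrix moves column `i` to
  -- column `i + 1`.
  shift : ∀ {m v} → Span e m v → Span e (suc m) (v ∘ suc)
  shift (null v≡0)            = null (v≡0 ∘ suc)
  shift (generator i i<m v≡e) =
    generator (suc i) (s≤s i<m) λ r → trans (v≡e (suc r)) (cong (f 0) (sym (ℕ.+-suc r i)))
  shift (combine α β v∈ w∈ x≡) = combine α β (shift v∈) (shift w∈) (x≡ ∘ suc)

  restore : ∀ {c} → Span e c (λ r → f c r - e c r) → Span e (suc c) (f c)
  restore {c} v∈ = combine 1ℚ 1ℚ (Span-weaken v∈) (generator c ℕ.≤-refl λ r → refl)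
    (λ r → solve 2 (λ x y → x := con 1ℚ :* (x :- y) :+ con 1ℚ :* y) refl (f c r) (e c r))

  -- Subtracting `e c` removes the monic leading term; by the recurrence the rest is a shift of the
  -- previous remainder plus earlier columns of `f`.
  f-e∈ : ∀ c → Span e c (λ r → f c r - e c r)
  f-e∈ zero = null λ r → trans (cong (λ j → f 0 r - f 0 j) (ℕ.+-identityʳ r)) (ℚ.+-inverseʳ (f 0 r))
  f-e∈ (suc zero) = combine 1ℚ (β 0) (shift (f-e∈ 0)) (restore (f-e∈ 0)) λ r → begin
    f 1 r - e 1 r
      ≡⟨ cong₂ _-_ (f₁ r) (cong (f 0) (ℕ.+-suc r 0)) ⟩
    f 0 (suc r) + β 0 * f 0 r - e 0 (suc r)
      ≡⟨ solve 4 (λ x b y z → x :+ b :* y :- z := con 1ℚ :* (x :- z) :+ b :* y) refl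
           (f 0 (suc r)) (β 0) (f 0 r) (e 0 (suc r)) ⟩
    1ℚ * (f 0 (suc r) - e 0 (suc r)) + β 0 * f 0 r ∎
  f-e∈ (suc (suc c)) =
    combine {w = λ r → β (suc c) * f (suc c) r + γ c * f c r} 1ℚ 1ℚ (shift (f-e∈ (suc c)))
      (combine (β (suc c)) (γ c) (restore (f-e∈ (suc c))) (Span-weaken (restore (f-e∈ c))) λ r → refl)
      λ r → begin
    f (2 ℕ.+ c) r - e (2 ℕ.+ c) r
      ≡⟨ cong₂ _-_ (f₂₊ c r) (cong (f 0) (ℕ.+-suc r (suc c))) ⟩
    f (suc c) (suc r) + β (suc c) * f (suc c) r + γ c * f c r - e (suc c) (suc r)
      ≡⟨ solve 4 (λ x y z w → x :+ y :+ z :- w := con 1ℚ :* (x :- w) :+ con 1ℚ :* (y :+ z)) refl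
           (f (suc c) (suc r)) (β (suc c) * f (suc c) r) (γ c * f c r) (e (suc c) (suc r)) ⟩
    1ℚ * (f (suc c) (suc r) - e (suc c) (suc r)) + 1ℚ * (β (suc c) * f (suc c) r + γ c * f c r) ∎

-- Determinants of triangular matrices

sum-zero : ∀ {n} {f : Fin n → ℚ} → (∀ i → f i ≡ 0ℚ) → sum {n} f ≡ 0ℚ
sum-zero {n} f≡0 = trans (sum-cong-≗ {n} f≡0) (sum-replicate-zero n)

product-zero : ∀ {n} {f : Fin n → ℚ} i → f i ≡ 0ℚ → product f ≡ 0ℚ
product-zero {f = f} zero    f≡0 = trans (cong (_* product (f ∘ suc)) f≡0) (ℚ.*-zeroˡ (product (f ∘ suc)))
product-zero {f = f} (suc i) f≡0 = trans (cong (f zero *_) (product-zero i f≡0)) (ℚ.*-zeroʳ (f zero))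

det-lowerTriangular : ∀ {n} (A : Matrix n) → (∀ r c → r Fin.< c → A r c ≡ 0ℚ) →
  det A ≡ product (λ i → A i i)
det-lowerTriangular {zero}  A upper = refl
det-lowerTriangular {suc n} A upper = begin
  1ℚ * A zero zero * det (minor A zero) + sum {n} (λ j → sign (suc j) * A zero (suc j) * det (minor A (suc j)))
    ≡⟨ cong₂ _+_
         (cong₂ _*_ (ℚ.*-identityˡ (A zero zero))
           (det-lowerTriangular (minor A zero) λ r c r<c → upper (suc r) (suc c) (s≤s r<c)))
         (sum-zero λ j → trans
           (cong (λ x → sign (suc j) * x * det (minor A (suc j))) (upper zero (suc j) (s≤s z≤n)))
           (solve 2 (λ s d → s :* con 0ℚ :* d := con 0ℚ) refl (sign (suc j)) (det (minor A (suc j))))) ⟩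
  product (λ i → A i i) + 0ℚ
    ≡⟨ ℚ.+-identityʳ _ ⟩
  product (λ i → A i i) ∎

punchIn-≥ : ∀ {n} (j : Fin (suc n)) c → toℕ c ℕ.≤ toℕ (punchIn j c)
punchIn-≥ zero    c       = ℕ.n≤1+n (toℕ c)
punchIn-≥ (suc j) zero    = z≤n
punchIn-≥ (suc j) (suc c) = s≤s (punchIn-≥ j c)

punchIn-inject₁ : ∀ {n} (j : Fin n) → punchIn (inject₁ j) j ≡ suc j
punchIn-inject₁ zero    = refl
punchIn-inject₁ (suc j) = cong suc (punchIn-inject₁ j)

punchIn-fromℕ : ∀ {n} (c : Fin n) → punchIn (fromℕ n) c ≡ inject₁ c
punchIn-fromℕ zero    = refl
punchIn-fromℕ (suc c) = cong suc (punchIn-fromℕ c)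

-- Below its first row A is lower triangular, so only the last column of that row has a minor
-- without a zero on its diagonal.
det-shiftedTriangular : ∀ {n} (A : Matrix (suc n)) →
  (∀ (r : Fin n) c → toℕ r ℕ.< toℕ c → A (suc r) c ≡ 0ℚ) →
  det A ≡ (- 1ℚ) ^ n * A zero (fromℕ n) * product (λ i → A (suc i) (inject₁ i))
det-shiftedTriangular {n} A upper = begin
  sum {suc n} term
    ≡⟨ sum-init-last {n} term ⟩
  sum {n} (term ∘ inject₁) + term (fromℕ n)
    ≡⟨ cong₂ _+_ (sum-zero vanish) last ⟩
  0ℚ + (- 1ℚ) ^ n * A zero (fromℕ n) * product (λ i → A (suc i) (inject₁ i))
    ≡⟨ ℚ.+-identityˡ _ ⟩
  (- 1ℚ) ^ n * A zero (fromℕ n) * product (λ i → A (suc i) (inject₁ i)) ∎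
  where
  term : Fin (suc n) → ℚ
  term j = sign j * A zero j * det (minor A j)

  -- Column `c` of a minor comes from a column of `A` at or right of `c`, so the zeros above the
  -- diagonal persist.
  det-minor : ∀ j → det (minor A j) ≡ product (λ i → A (suc i) (punchIn j i))
  det-minor j = det-lowerTriangular (minor A j) λ r c r<c →
    upper r (punchIn j c) (ℕ.<-≤-trans r<c (punchIn-≥ j c))

  -- Deleting column `j` puts the zero entry `A (suc j) (suc j)` on the diagonal of the minor.
  vanish : ∀ j → term (inject₁ j) ≡ 0ℚ
  vanish j = trans
    (cong (sign (inject₁ j) * A zero (inject₁ j) *_) (trans (det-minor (inject₁ j))
      (product-zero j (upper j (punchIn (inject₁ j) j)
        (ℕ.≤-reflexive (sym (cong toℕ (punchIn-inject₁ j))))))))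
    (ℚ.*-zeroʳ (sign (inject₁ j) * A zero (inject₁ j)))

  last : term (fromℕ n) ≡ (- 1ℚ) ^ n * A zero (fromℕ n) * product (λ i → A (suc i) (inject₁ i))
  last = cong₂ (λ m d → (- 1ℚ) ^ m * A zero (fromℕ n) * d) (Fin.toℕ-fromℕ n)
    (trans (det-minor (fromℕ n)) (product-cong λ i → cong (A (suc i)) (punchIn-fromℕ i)))

-- Embedding of ℕ into ℚ

ι : ℕ → ℚ
ι n = + n / 1

fromℚᵘ-homo-+ : ∀ p q → fromℚᵘ (p ℚᵘ.+ q) ≡ fromℚᵘ p + fromℚᵘ q
fromℚᵘ-homo-+ p q = ℚ.toℚᵘ-injective (ℚᵘ.≃-trans (ℚ.toℚᵘ-fromℚᵘ (p ℚᵘ.+ q))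
  (ℚᵘ.≃-sym (ℚᵘ.≃-trans (ℚ.toℚᵘ-homo-+ (fromℚᵘ p) (fromℚᵘ q))
    (ℚᵘ.+-cong (ℚ.toℚᵘ-fromℚᵘ p) (ℚ.toℚᵘ-fromℚᵘ q)))))

fromℚᵘ-homo-* : ∀ p q → fromℚᵘ (p ℚᵘ.* q) ≡ fromℚᵘ p * fromℚᵘ q
fromℚᵘ-homo-* p q = ℚ.toℚᵘ-injective (ℚᵘ.≃-trans (ℚ.toℚᵘ-fromℚᵘ (p ℚᵘ.* q))
  (ℚᵘ.≃-sym (ℚᵘ.≃-trans (ℚ.toℚᵘ-homo-* (fromℚᵘ p) (fromℚᵘ q))
    (ℚᵘ.*-cong (ℚ.toℚᵘ-fromℚᵘ p) (ℚ.toℚᵘ-fromℚᵘ q)))))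

ι-+ : ∀ m n → ι (m ℕ.+ n) ≡ ι m + ι n
ι-+ m n = trans
  (cong (_/ 1) (sym (cong₂ ℤ._+_ (ℤ.*-identityʳ (+ m)) (ℤ.*-identityʳ (+ n)))))
  (fromℚᵘ-homo-+ (mkℚᵘ (+ m) 0) (mkℚᵘ (+ n) 0))

ι-* : ∀ m n → ι (m ℕ.* n) ≡ ι m * ι n
ι-* m n = trans (cong (_/ 1) (ℤ.pos-* m n)) (fromℚᵘ-homo-* (mkℚᵘ (+ m) 0) (mkℚᵘ (+ n) 0))

/≡ι* : ∀ m d .{{_ : ℕ.NonZero d}} → + m / d ≡ ι m * (+ 1 / d)
/≡ι* m (suc d) = trans
  (ℚ.fromℚᵘ-cong {mkℚᵘ (+ m) d} {mkℚᵘ (+ m) 0 ℚᵘ.* mkℚᵘ (+ 1) d} (*≡* (begin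
    + m ℤ.* (+ 1 ℤ.* + suc d)  ≡⟨ cong (+ m ℤ.*_) (ℤ.*-identityˡ (+ suc d)) ⟩
    + m ℤ.* + suc d            ≡⟨ cong (ℤ._* + suc d) (sym (ℤ.*-identityʳ (+ m))) ⟩
    + m ℤ.* + 1 ℤ.* + suc d    ∎)))
  (fromℚᵘ-homo-* (mkℚᵘ (+ m) 0) (mkℚᵘ (+ 1) d))

ι*1/ : ∀ d .{{_ : ℕ.NonZero d}} → ι d * (+ 1 / d) ≡ 1ℚ
ι*1/ d@(suc d-1) = trans (sym (/≡ι* d d))
  (ℚ.fromℚᵘ-cong {mkℚᵘ (+ d) d-1} {mkℚᵘ (+ 1) 0} (*≡* (ℤ.*-comm (+ d) (+ 1))))

1/!-suc : ∀ n → ι (suc n) * (+ 1 /! suc n) ≡ + 1 /! n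
1/!-suc n = begin
  ι (suc n) * r′
    ≡⟨ sym (ℚ.*-identityʳ _) ⟩
  ι (suc n) * r′ * 1ℚ
    ≡⟨ cong (ι (suc n) * r′ *_) (sym (ι*1/ (n !) {{n ℕ.!≢0}})) ⟩
  ι (suc n) * r′ * (ι (n !) * r)
    ≡⟨ solve 4 (λ x y z w → x :* y :* (z :* w) := (x :* z) :* y :* w) refl (ι (suc n)) r′ (ι (n !)) r ⟩
  ι (suc n) * ι (n !) * r′ * r
    ≡⟨ cong (λ x → x * r′ * r) (sym (ι-* (suc n) (n !))) ⟩
  ι (suc n !) * r′ * r
    ≡⟨ cong (_* r) (ι*1/ (suc n !) {{suc n ℕ.!≢0}}) ⟩
  1ℚ * r
    ≡⟨ ℚ.*-identityˡ r ⟩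
  r ∎
  where
  r r′ : ℚ
  r  = + 1 /! n
  r′ = + 1 /! suc n

-- Formal power series

⊗-cong : ∀ {f g h k : Series} → (∀ n → f n ≡ g n) → (∀ n → h n ≡ k n) →
  ∀ n → (f ⊗ h) n ≡ (g ⊗ k) n
⊗-cong f≗g h≗k n = sum-cong-≗ {suc n} λ i → cong₂ _*_ (f≗g (toℕ i)) (h≗k (n ∸ toℕ i))

⊗-distribʳ : ∀ f g h n → ((g ⊕ h) ⊗ f) n ≡ (g ⊗ f) n + (h ⊗ f) n
⊗-distribʳ f g h n = trans
  (sum-cong-≗ {suc n} λ i → ℚ.*-distribʳ-+ (f (n ∸ toℕ i)) (g (toℕ i)) (h (toℕ i)))
  (∑-distrib-+ {suc n} (λ i → g (toℕ i) * f (n ∸ toℕ i)) (λ i → h (toℕ i) * f (n ∸ toℕ i)))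

⊗-linear : ∀ (f g h : Series) α β n →
  (f ⊗ (λ k → α * g k + β * h k)) n ≡ α * (f ⊗ g) n + β * (f ⊗ h) n
⊗-linear f g h α β n = begin
  sum {suc n} (λ i → f (toℕ i) * (α * g (n ∸ toℕ i) + β * h (n ∸ toℕ i)))
    ≡⟨ sum-cong-≗ {suc n} (λ i → solve 5 (λ f a g b h → f :* (a :* g :+ b :* h)
         := a :* (f :* g) :+ b :* (f :* h)) refl (f (toℕ i)) α (g (n ∸ toℕ i)) β (h (n ∸ toℕ i))) ⟩
  sum {suc n} (λ i → α * fg i + β * fh i)
    ≡⟨ ∑-distrib-+ {suc n} (λ i → α * fg i) (λ i → β * fh i) ⟩
  sum {suc n} (λ i → α * fg i) + sum {suc n} (λ i → β * fh i)
    ≡⟨ sym (cong₂ _+_ (*-distribˡ-sum {suc n} α fg) (*-distribˡ-sum {suc n} β fh)) ⟩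
  α * (f ⊗ g) n + β * (f ⊗ h) n ∎
  where
  fg fh : Fin (suc n) → ℚ
  fg i = f (toℕ i) * g (n ∸ toℕ i)
  fh i = f (toℕ i) * h (n ∸ toℕ i)

⊗-identityˡ : ∀ f n → (constant 1ℚ ⊗ f) n ≡ f n
⊗-identityˡ f n = begin
  1ℚ * f n + sum {n} (λ i → 0ℚ * f (n ∸ suc (toℕ i)))
    ≡⟨ cong₂ _+_ (ℚ.*-identityˡ (f n)) (sum-zero {n} λ i → ℚ.*-zeroˡ (f (n ∸ suc (toℕ i)))) ⟩
  f n + 0ℚ  ≡⟨ ℚ.+-identityʳ (f n) ⟩
  f n       ∎

-- Apart from the term with the invertible `g 0`, the n-th coefficient involves only earlier
-- coefficients, which agree by strong induction.
⊗-cancelˡ : ∀ (g f h : Series) c → c * g 0 ≡ 1ℚ → (∀ n → (g ⊗ f) n ≡ (g ⊗ h) n) → ∀ n → f n ≡ h n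
⊗-cancelˡ g f h c cg₀≡1 gf≗gh = <-rec (λ n → f n ≡ h n) λ n ih → begin
  f n              ≡⟨ unscale (f n) ⟩
  c * (g 0 * f n)  ≡⟨ cong (c *_) (+-cancelʳ (tail n f) (g 0 * f n) (g 0 * h n)
                        (trans (gf≗gh n) (cong (λ z → g 0 * h n + z) (sym (tail-cong n ih))))) ⟩
  c * (g 0 * h n)  ≡⟨ sym (unscale (h n)) ⟩
  h n              ∎
  where
  tail : ℕ → Series → ℚ
  tail n f = sum {n} (λ i → g (suc (toℕ i)) * f (n ∸ suc (toℕ i)))

  tail-cong : ∀ n → (∀ {m} → m ℕ.< n → f m ≡ h m) → tail n f ≡ tail n h
  tail-cong n ih = sum-cong-≗ {n} λ i →
    cong (g (suc (toℕ i)) *_) (ih (ℕ.∸-monoʳ-< {n} (s≤s z≤n) (Fin.toℕ<n i)))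

  unscale : ∀ x → x ≡ c * (g 0 * x)
  unscale x = begin
    x              ≡⟨ sym (ℚ.*-identityˡ x) ⟩
    1ℚ * x         ≡⟨ cong (_* x) (sym cg₀≡1) ⟩
    c * g 0 * x    ≡⟨ ℚ.*-assoc c (g 0) x ⟩
    c * (g 0 * x)  ∎

derivative : Series → Series
derivative f n = ι (suc n) * f (suc n)

-- t times the derivative; unlike the derivative itself it does not shift indices.
θ : Series → Series
θ f n = ι n * f n

-- In each term of the Cauchy product the two degrees add up to `n`.
⊗-θ : ∀ g f n → ι n * (g ⊗ f) n ≡ (θ g ⊗ f) n + (g ⊗ θ f) n
⊗-θ g f n = begin
  ι n * (g ⊗ f) n
    ≡⟨ *-distribˡ-sum {suc n} (ι n) (λ i → g (toℕ i) * f (n ∸ toℕ i)) ⟩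
  sum {suc n} (λ i → ι n * (g (toℕ i) * f (n ∸ toℕ i)))
    ≡⟨ sum-cong-≗ {suc n} split ⟩
  sum {suc n} (λ i → θ g (toℕ i) * f (n ∸ toℕ i) + g (toℕ i) * θ f (n ∸ toℕ i))
    ≡⟨ ∑-distrib-+ {suc n} (λ i → θ g (toℕ i) * f (n ∸ toℕ i)) (λ i → g (toℕ i) * θ f (n ∸ toℕ i)) ⟩
  (θ g ⊗ f) n + (g ⊗ θ f) n ∎
  where
  split : ∀ i → ι n * (g (toℕ i) * f (n ∸ toℕ i)) ≡
                θ g (toℕ i) * f (n ∸ toℕ i) + g (toℕ i) * θ f (n ∸ toℕ i)
  split i = begin
    ι n * (g j * f (n ∸ j))
      ≡⟨ cong (λ m → ι m * (g j * f (n ∸ j))) (sym (ℕ.m+[n∸m]≡n (ℕ.s≤s⁻¹ (Fin.toℕ<n i)))) ⟩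
    ι (j ℕ.+ (n ∸ j)) * (g j * f (n ∸ j))
      ≡⟨ cong (_* (g j * f (n ∸ j))) (ι-+ j (n ∸ j)) ⟩
    (ι j + ι (n ∸ j)) * (g j * f (n ∸ j))
      ≡⟨ solve 4 (λ x y g f → (x :+ y) :* (g :* f) := x :* g :* f :+ g :* (y :* f)) refl
           (ι j) (ι (n ∸ j)) (g j) (f (n ∸ j)) ⟩
    θ g j * f (n ∸ j) + g j * θ f (n ∸ j) ∎
    where
    j : ℕ
    j = toℕ i

⊗-sucˡ : ∀ g f n → g 0 ≡ 0ℚ → (g ⊗ f) (suc n) ≡ ((g ∘ suc) ⊗ f) n
⊗-sucˡ g f n g₀≡0 = begin
  g 0 * f (suc n) + ((g ∘ suc) ⊗ f) n  ≡⟨ cong (λ x → x * f (suc n) + ((g ∘ suc) ⊗ f) n) g₀≡0 ⟩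
  0ℚ * f (suc n) + ((g ∘ suc) ⊗ f) n   ≡⟨ cong (_+ ((g ∘ suc) ⊗ f) n) (ℚ.*-zeroˡ (f (suc n))) ⟩
  0ℚ + ((g ∘ suc) ⊗ f) n               ≡⟨ ℚ.+-identityˡ _ ⟩
  ((g ∘ suc) ⊗ f) n                    ∎

⊗-sucʳ : ∀ g f n → f 0 ≡ 0ℚ → (g ⊗ f) (suc n) ≡ (g ⊗ (f ∘ suc)) n
⊗-sucʳ g f zero f₀≡0 = begin
  g 0 * f 1 + (g 1 * f 0 + 0ℚ)  ≡⟨ cong (λ x → g 0 * f 1 + (g 1 * x + 0ℚ)) f₀≡0 ⟩
  g 0 * f 1 + (g 1 * 0ℚ + 0ℚ)   ≡⟨ solve 2 (λ x y → x :+ (y :* con 0ℚ :+ con 0ℚ) := x :+ con 0ℚ) refl (g 0 * f 1) (g 1) ⟩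
  g 0 * f 1 + 0ℚ                ∎
⊗-sucʳ g f (suc n) f₀≡0 = cong (λ z → g 0 * f (2 ℕ.+ n) + z) (⊗-sucʳ (g ∘ suc) f n f₀≡0)

-- This is `⊗-θ` divided by t: `θ g` and `θ f` have constant term zero, so the index shift passes to
-- that factor.
⊗-derivative : ∀ g f n →
  derivative (g ⊗ f) n ≡ (derivative g ⊗ f) n + (g ⊗ derivative f) n
⊗-derivative g f n = trans (⊗-θ g f (suc n))
  (cong₂ _+_ (⊗-sucˡ (θ g) f n (ℚ.*-zeroˡ (g 0))) (⊗-sucʳ g (θ f) n (ℚ.*-zeroˡ (f 0))))

-- Exponential generating functions

egf : (ℕ → ℚ) → Series
egf a n = a n * (+ 1 /! n)

derivative-egf : ∀ a n → derivative (egf a) n ≡ egf (a ∘ suc) n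
derivative-egf a n = begin
  ι (suc n) * (a (suc n) * (+ 1 /! suc n))
    ≡⟨ solve 3 (λ x a r → x :* (a :* r) := a :* (x :* r)) refl (ι (suc n)) (a (suc n)) (+ 1 /! suc n) ⟩
  a (suc n) * (ι (suc n) * (+ 1 /! suc n))
    ≡⟨ cong (a (suc n) *_) (1/!-suc n) ⟩
  egf (a ∘ suc) n ∎

1^n≡1 : ∀ n → 1ℚ ^ n ≡ 1ℚ
1^n≡1 zero    = refl
1^n≡1 (suc n) = trans (ℚ.*-identityˡ (1ℚ ^ n)) (1^n≡1 n)

exp : Series
exp = exp[ 1ℚ t]

derivative-exp : ∀ n → derivative exp n ≡ exp n
derivative-exp n = trans (derivative-egf (1ℚ ^_) n) (cong (_* (+ 1 /! n)) (ℚ.*-identityˡ (1ℚ ^ n)))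

-- The moments of the Euler polynomials at 1

-- The sequence with exponential generating function wⁿ, where w = (1 - e^t) / (1 + e^t)
-- satisfies w′ = (w² - 1) / 2.
ω : ℕ → ℕ → ℚ
ω zero    zero    = 1ℚ
ω (suc n) zero    = 0ℚ
ω zero    (suc k) = 0ℚ
ω (suc n) (suc k) = ½ * ι (suc n) * (ω (2 ℕ.+ n) k - ω n k)

-- The exponential generating functions are wⁿ (1 + w) and wⁿ (1 - w).
ω⁺ ω⁻ : ℕ → ℕ → ℚ
ω⁺ n k = ω n k + ω (suc n) k
ω⁻ n k = ω n k - ω (suc n) k

ι-suc : ∀ n → ι (suc n) ≡ 1ℚ + ι n
ι-suc = ι-+ 1

-- The formula for w′ expresses the derivative of wⁿ (1 + w) through series of the same form. At
-- `n = 0` the truncated `n ∸ 1` comes with the factor `ι 0`.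
ω⁺-suc : ∀ n k → ω⁺ n (suc k) ≡ ½ * (ι (suc n) * ω⁺ (suc n) k - ω⁺ n k - ι n * ω⁺ (n ∸ 1) k)
ω⁺-suc zero k =
  solve 3 (λ x y z → con 0ℚ :+ con ½ :* con 1ℚ :* (z :- x)
    := con ½ :* (con 1ℚ :* (y :+ z) :- (x :+ y) :- con 0ℚ :* (x :+ y))) refl (ω 0 k) (ω 1 k) (ω 2 k)
ω⁺-suc (suc n) k rewrite ι-suc (suc n) =
  solve 5 (λ m x y z w → con ½ :* m :* (z :- x) :+ con ½ :* (con 1ℚ :+ m) :* (w :- y)
    := con ½ :* ((con 1ℚ :+ m) :* (z :+ w) :- (y :+ z) :- m :* (x :+ y))) refl
    (ι (suc n)) (ω n k) (ω (1 ℕ.+ n) k) (ω (2 ℕ.+ n) k) (ω (3 ℕ.+ n) k)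

ω⁻-suc : ∀ n k → ω⁻ n (suc k) ≡ ½ * (ι (suc n) * ω⁻ (suc n) k + ω⁻ n k - ι n * ω⁻ (n ∸ 1) k)
ω⁻-suc zero k =
  solve 3 (λ x y z → con 0ℚ :- con ½ :* con 1ℚ :* (z :- x)
    := con ½ :* (con 1ℚ :* (y :- z) :+ (x :- y) :- con 0ℚ :* (x :- y))) refl (ω 0 k) (ω 1 k) (ω 2 k)
ω⁻-suc (suc n) k rewrite ι-suc (suc n) =
  solve 5 (λ m x y z w → con ½ :* m :* (z :- x) :- con ½ :* (con 1ℚ :+ m) :* (w :- y)
    := con ½ :* ((con 1ℚ :+ m) :* (z :- w) :+ (y :- z) :- m :* (x :- y))) refl
    (ι (suc n)) (ω n k) (ω (1 ℕ.+ n) k) (ω (2 ℕ.+ n) k) (ω (3 ℕ.+ n) k)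

-- e^t (1 + w) = 1 - w, multiplied by wⁿ.
exp⊗ω⁺ : ∀ k n → (exp ⊗ egf (ω⁺ n)) k ≡ egf (ω⁻ n) k
exp⊗ω⁺ zero zero    = refl
exp⊗ω⁺ zero (suc n) = refl
-- Coefficient `k + 1` is coefficient `k` of the derivative divided by `k + 1`. The derivative
-- involves the indices `n ∸ 1`, `n` and `n + 1`, so the induction on `k` covers all `n` at once.
exp⊗ω⁺ (suc k) n = begin
  (exp ⊗ egf (ω⁺ n)) (suc k)
    ≡⟨ unscale _ ⟩
  q * derivative (exp ⊗ egf (ω⁺ n)) k
    ≡⟨ cong (q *_) (begin
      derivative (exp ⊗ egf (ω⁺ n)) k
        ≡⟨ ⊗-derivative exp (egf (ω⁺ n)) k ⟩
      (derivative exp ⊗ egf (ω⁺ n)) k + (exp ⊗ derivative (egf (ω⁺ n))) k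
        ≡⟨ cong₂ _+_ (⊗-cong {h = egf (ω⁺ n)} derivative-exp (λ _ → refl) k)
             (⊗-cong {exp} (λ _ → refl) expand k) ⟩
      (exp ⊗ egf (ω⁺ n)) k +
      (exp ⊗ (λ j → ½ * (ι (suc n) * egf (ω⁺ (suc n)) j + - 1ℚ * egf (ω⁺ n) j)
                    + - ½ * ι n * egf (ω⁺ (n ∸ 1)) j)) k
        ≡⟨ cong (λ z → (exp ⊗ egf (ω⁺ n)) k + z) (begin
             (exp ⊗ (λ j → ½ * (ι (suc n) * egf (ω⁺ (suc n)) j + - 1ℚ * egf (ω⁺ n) j)
                           + - ½ * ι n * egf (ω⁺ (n ∸ 1)) j)) k
               ≡⟨ ⊗-linear exp (λ j → ι (suc n) * egf (ω⁺ (suc n)) j + - 1ℚ * egf (ω⁺ n) j)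
                    (egf (ω⁺ (n ∸ 1))) ½ (- ½ * ι n) k ⟩
             ½ * (exp ⊗ (λ j → ι (suc n) * egf (ω⁺ (suc n)) j + - 1ℚ * egf (ω⁺ n) j)) k
               + - ½ * ι n * (exp ⊗ egf (ω⁺ (n ∸ 1))) k
               ≡⟨ cong (λ x → ½ * x + - ½ * ι n * (exp ⊗ egf (ω⁺ (n ∸ 1))) k)
                    (⊗-linear exp (egf (ω⁺ (suc n))) (egf (ω⁺ n)) (ι (suc n)) (- 1ℚ) k) ⟩
             ½ * (ι (suc n) * (exp ⊗ egf (ω⁺ (suc n))) k + - 1ℚ * (exp ⊗ egf (ω⁺ n)) k)
               + - ½ * ι n * (exp ⊗ egf (ω⁺ (n ∸ 1))) k ∎) ⟩
      (exp ⊗ egf (ω⁺ n)) k +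
      (½ * (ι (suc n) * (exp ⊗ egf (ω⁺ (suc n))) k + - 1ℚ * (exp ⊗ egf (ω⁺ n)) k)
       + - ½ * ι n * (exp ⊗ egf (ω⁺ (n ∸ 1))) k)
        ≡⟨ cong₂ _+_ (exp⊗ω⁺ k n) (cong₂ _+_
             (cong₂ (λ x y → ½ * (ι (suc n) * x + - 1ℚ * y)) (exp⊗ω⁺ k (suc n)) (exp⊗ω⁺ k n))
             (cong (- ½ * ι n *_) (exp⊗ω⁺ k (n ∸ 1)))) ⟩
      egf (ω⁻ n) k +
      (½ * (ι (suc n) * egf (ω⁻ (suc n)) k + - 1ℚ * egf (ω⁻ n) k) + - ½ * ι n * egf (ω⁻ (n ∸ 1)) k)
        -- The extra `egf (ω⁻ n)` from differentiating e^t turns the coefficient -½ of `ω⁺-suc` into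
        -- the +½ of `ω⁻-suc`.
        ≡⟨ solve 6 (λ m m′ x y z r →
             y :* r :+ (con ½ :* (m′ :* (z :* r) :+ con (- 1ℚ) :* (y :* r)) :+ con (- ½) :* m :* (x :* r))
             := con ½ :* (m′ :* z :+ y :- m :* x) :* r) refl
             (ι n) (ι (suc n)) (ω⁻ (n ∸ 1) k) (ω⁻ n k) (ω⁻ (suc n) k) (+ 1 /! k) ⟩
      ½ * (ι (suc n) * ω⁻ (suc n) k + ω⁻ n k - ι n * ω⁻ (n ∸ 1) k) * (+ 1 /! k)
        ≡⟨ cong (_* (+ 1 /! k)) (sym (ω⁻-suc n k)) ⟩
      egf (ω⁻ n ∘ suc) k
        ≡⟨ sym (derivative-egf (ω⁻ n) k) ⟩
      derivative (egf (ω⁻ n)) k ∎) ⟩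
  q * derivative (egf (ω⁻ n)) k
    ≡⟨ sym (unscale _) ⟩
  egf (ω⁻ n) (suc k) ∎
  where
  q : ℚ
  q = + 1 / suc k

  unscale : ∀ x → x ≡ q * (ι (suc k) * x)
  unscale x = begin
    x                    ≡⟨ sym (ℚ.*-identityˡ x) ⟩
    1ℚ * x               ≡⟨ cong (_* x) (sym (ι*1/ (suc k))) ⟩
    ι (suc k) * q * x    ≡⟨ solve 3 (λ a q x → a :* q :* x := q :* (a :* x)) refl (ι (suc k)) q x ⟩
    q * (ι (suc k) * x)  ∎

  expand : ∀ j → derivative (egf (ω⁺ n)) j ≡
    ½ * (ι (suc n) * egf (ω⁺ (suc n)) j + - 1ℚ * egf (ω⁺ n) j) + - ½ * ι n * egf (ω⁺ (n ∸ 1)) j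
  expand j = begin
    derivative (egf (ω⁺ n)) j
      ≡⟨ derivative-egf (ω⁺ n) j ⟩
    ω⁺ n (suc j) * (+ 1 /! j)
      ≡⟨ cong (_* (+ 1 /! j)) (ω⁺-suc n j) ⟩
    ½ * (ι (suc n) * ω⁺ (suc n) j - ω⁺ n j - ι n * ω⁺ (n ∸ 1) j) * (+ 1 /! j)
      ≡⟨ solve 6 (λ m m′ x y z r → con ½ :* (m′ :* z :- y :- m :* x) :* r
           := con ½ :* (m′ :* (z :* r) :+ con (- 1ℚ) :* (y :* r)) :+ con (- ½) :* m :* (x :* r)) refl
           (ι n) (ι (suc n)) (ω⁺ (n ∸ 1) j) (ω⁺ n j) (ω⁺ (suc n) j) (+ 1 /! j) ⟩
    ½ * (ι (suc n) * egf (ω⁺ (suc n)) j + - 1ℚ * egf (ω⁺ n) j) + - ½ * ι n * egf (ω⁺ (n ∸ 1)) j ∎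

-- With (e^t + 1)(1 - w) = e^t (1 - w) + e^t (1 + w) = 2 e^t.
expt+1⊗ω⁻ : ∀ n → (expt+1 ⊗ egf (ω⁻ 0)) n ≡ 2exp[ 1ℚ t] n
expt+1⊗ω⁻ n = begin
  (expt+1 ⊗ egf (ω⁻ 0)) n
    ≡⟨ ⊗-distribʳ (egf (ω⁻ 0)) exp (constant 1ℚ) n ⟩
  (exp ⊗ egf (ω⁻ 0)) n + (constant 1ℚ ⊗ egf (ω⁻ 0)) n
    ≡⟨ cong (λ z → (exp ⊗ egf (ω⁻ 0)) n + z)
         (trans (⊗-identityˡ (egf (ω⁻ 0)) n) (sym (exp⊗ω⁺ n 0))) ⟩
  (exp ⊗ egf (ω⁻ 0)) n + (exp ⊗ egf (ω⁺ 0)) n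
    ≡⟨ solve 2 (λ x y → x :+ y := con 1ℚ :* x :+ con 1ℚ :* y) refl
         ((exp ⊗ egf (ω⁻ 0)) n) ((exp ⊗ egf (ω⁺ 0)) n) ⟩
  1ℚ * (exp ⊗ egf (ω⁻ 0)) n + 1ℚ * (exp ⊗ egf (ω⁺ 0)) n
    ≡⟨ sym (⊗-linear exp (egf (ω⁻ 0)) (egf (ω⁺ 0)) 1ℚ 1ℚ n) ⟩
  (exp ⊗ (λ k → 1ℚ * egf (ω⁻ 0) k + 1ℚ * egf (ω⁺ 0) k)) n
    -- The sum of 1 - w and 1 + w is 2, padded with a zero multiple so that `⊗-linear` applies.
    ≡⟨ ⊗-cong {exp} (λ _ → refl) constant-2 n ⟩
  (exp ⊗ (λ k → ι 2 * constant 1ℚ k + 0ℚ * constant 1ℚ k)) n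
    ≡⟨ ⊗-linear exp (constant 1ℚ) (constant 1ℚ) (ι 2) 0ℚ n ⟩
  ι 2 * (exp ⊗ constant 1ℚ) n + 0ℚ * (exp ⊗ constant 1ℚ) n
    ≡⟨ solve 1 (λ x → con (ι 2) :* x :+ con 0ℚ :* x := con (ι 2) :* x) refl ((exp ⊗ constant 1ℚ) n) ⟩
  ι 2 * (exp ⊗ constant 1ℚ) n
    ≡⟨ cong (ι 2 *_) (⊗-identityʳ exp n) ⟩
  ι 2 * exp n ∎
  where
  constant-2 : ∀ k → 1ℚ * egf (ω⁻ 0) k + 1ℚ * egf (ω⁺ 0) k ≡ ι 2 * constant 1ℚ k + 0ℚ * constant 1ℚ k
  constant-2 zero    = refl
  constant-2 (suc k) = solve 2 (λ x r →
    con 1ℚ :* ((con 0ℚ :- x) :* r) :+ con 1ℚ :* ((con 0ℚ :+ x) :* r)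
    := con (ι 2) :* con 0ℚ :+ con 0ℚ :* con 0ℚ) refl (ω 1 (suc k)) (+ 1 /! suc k)

  ⊗-identityʳ : ∀ g n → (g ⊗ constant 1ℚ) n ≡ g n
  ⊗-identityʳ g zero    = solve 1 (λ x → x :* con 1ℚ :+ con 0ℚ := x) refl (g 0)
  ⊗-identityʳ g (suc n) = begin
    g 0 * 0ℚ + ((g ∘ suc) ⊗ constant 1ℚ) n  ≡⟨ cong₂ _+_ (ℚ.*-zeroʳ (g 0)) (⊗-identityʳ (g ∘ suc) n) ⟩
    0ℚ + g (suc n)                          ≡⟨ ℚ.+-identityˡ (g (suc n)) ⟩
    g (suc n)                               ∎

-- Both generating functions give 2e^t when multiplied by e^t + 1, whose constant term 2 has inverse
-- `½`.
E≡ω⁻ : ∀ k → E k 1ℚ ≡ ω⁻ 0 k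
E≡ω⁻ k = begin
  E k 1ℚ                         ≡⟨ unscale (E k 1ℚ) ⟩
  ι (k !) * egf (λ k → E k 1ℚ) k ≡⟨ cong (ι (k !) *_) (⊗-cancelˡ expt+1 (egf (λ k → E k 1ℚ)) (egf (ω⁻ 0)) ½ refl
                                      (λ n → trans (E-generating 1ℚ n) (sym (expt+1⊗ω⁻ n))) k) ⟩
  ι (k !) * egf (ω⁻ 0) k         ≡⟨ sym (unscale (ω⁻ 0 k)) ⟩
  ω⁻ 0 k                         ∎
  where
  unscale : ∀ x → x ≡ ι (k !) * (x * (+ 1 /! k))
  unscale x = begin
    x                            ≡⟨ sym (ℚ.*-identityʳ x) ⟩
    x * 1ℚ                       ≡⟨ cong (x *_) (sym (ι*1/ (k !) {{k ℕ.!≢0}})) ⟩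
    x * (ι (k !) * (+ 1 /! k))   ≡⟨ solve 3 (λ x a r → x :* (a :* r) := a :* (x :* r)) refl x (ι (k !)) (+ 1 /! k) ⟩
    ι (k !) * (x * (+ 1 /! k))   ∎

-- κ n = n! / 2ⁿ
κ : ℕ → ℚ
κ zero    = 1ℚ
κ (suc n) = ½ * ι (suc n) * κ n

-- u n k = L (xᵏ Pₙ), where L (xᵏ) = Eₖ(1) and P₀, P₁, … are the monic orthogonal polynomials of L.
u : ℕ → ℕ → ℚ
u n k = κ n * ω⁻ n k

-- The coefficients of Pₙ₊₂ = (x - ½) Pₙ₊₁ + γ n Pₙ.
γ : ℕ → ℚ
γ n = ½ * ι (suc n) * (½ * ι (suc n))

u-1 : ∀ k → u 1 k ≡ u 0 (suc k) + - ½ * u 0 k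
u-1 k = begin
  u 1 k
    ≡⟨ solve 2 (λ x y → con (κ 1) :* y
         := con 1ℚ :* (con ½ :* (con 1ℚ :* y :+ x :- con 0ℚ :* x)) :+ con (- ½) :* (con 1ℚ :* x)) refl
         (ω⁻ 0 k) (ω⁻ 1 k) ⟩
  1ℚ * (½ * (1ℚ * ω⁻ 1 k + ω⁻ 0 k - 0ℚ * ω⁻ 0 k)) + - ½ * u 0 k
    ≡⟨ cong (λ x → 1ℚ * x + - ½ * u 0 k) (sym (ω⁻-suc 0 k)) ⟩
  u 0 (suc k) + - ½ * u 0 k ∎

-- This is `ω⁻-suc` solved for its term of index `n + 2`; the factor `κ` makes the coefficient of
-- `u (suc n) (suc k)` equal to 1, so that the Pₙ are monic.
u-2+ : ∀ n k → u (2 ℕ.+ n) k ≡ u (suc n) (suc k) + - ½ * u (suc n) k + γ n * u n k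
u-2+ n k = begin
  u (2 ℕ.+ n) k
    ≡⟨ solve 6 (λ m m′ κ x y z → con ½ :* m′ :* (con ½ :* m :* κ) :* z
         := con ½ :* m :* κ :* (con ½ :* (m′ :* z :+ y :- m :* x)) :+ con (- ½) :* (con ½ :* m :* κ :* y)
            :+ con ½ :* m :* (con ½ :* m) :* (κ :* x)) refl
         (ι (suc n)) (ι (2 ℕ.+ n)) (κ n) (ω⁻ n k) (ω⁻ (suc n) k) (ω⁻ (2 ℕ.+ n) k) ⟩
  κ (suc n) * (½ * (ι (2 ℕ.+ n) * ω⁻ (2 ℕ.+ n) k + ω⁻ (suc n) k - ι (suc n) * ω⁻ n k))
    + - ½ * u (suc n) k + γ n * u n k
    ≡⟨ cong (λ x → κ (suc n) * x + - ½ * u (suc n) k + γ n * u n k) (sym (ω⁻-suc (suc n) k)) ⟩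
  u (suc n) (suc k) + - ½ * u (suc n) k + γ n * u n k ∎

-- Orthogonality and norms

ω-vanishes : ∀ {n k} → k ℕ.< n → ω n k ≡ 0ℚ
ω-vanishes {suc n} {zero}  k<n = refl
ω-vanishes {suc n} {suc k} k<n = begin
  ½ * ι (suc n) * (ω (2 ℕ.+ n) k - ω n k)
    ≡⟨ cong₂ (λ x y → ½ * ι (suc n) * (x - y))
         (ω-vanishes (ℕ.m<n⇒m<1+n (ℕ.m<n⇒m<1+n (ℕ.s≤s⁻¹ k<n)))) (ω-vanishes (ℕ.s≤s⁻¹ k<n)) ⟩
  ½ * ι (suc n) * (0ℚ - 0ℚ)
    ≡⟨ ℚ.*-zeroʳ (½ * ι (suc n)) ⟩
  0ℚ ∎

-- The series w begins with -t/2, hence wⁿ with (-1/2)ⁿ tⁿ; the factor n! is that of the exponential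
-- generating function.
ω-diagonal : ∀ n → ω n n ≡ (- 1ℚ) ^ n * κ n
ω-diagonal zero    = refl
ω-diagonal (suc n) = begin
  ½ * ι (suc n) * (ω (2 ℕ.+ n) n - ω n n)
    ≡⟨ cong₂ (λ x y → ½ * ι (suc n) * (x - y)) (ω-vanishes (ℕ.m<n⇒m<1+n (ℕ.n<1+n n))) (ω-diagonal n) ⟩
  ½ * ι (suc n) * (0ℚ - (- 1ℚ) ^ n * κ n)
    ≡⟨ solve 3 (λ m p κ → con ½ :* m :* (con 0ℚ :- p :* κ) := con (- 1ℚ) :* p :* (con ½ :* m :* κ)) refl
         (ι (suc n)) ((- 1ℚ) ^ n) (κ n) ⟩
  (- 1ℚ) ^ suc n * κ (suc n) ∎

u-vanishes : ∀ {n k} → k ℕ.< n → u n k ≡ 0ℚ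
u-vanishes {n} {k} k<n = begin
  κ n * (ω n k - ω (suc n) k)
    ≡⟨ cong₂ (λ x y → κ n * (x - y)) (ω-vanishes k<n) (ω-vanishes (ℕ.m<n⇒m<1+n k<n)) ⟩
  κ n * (0ℚ - 0ℚ)  ≡⟨ ℚ.*-zeroʳ (κ n) ⟩
  0ℚ               ∎

u-diagonal : ∀ n → u n n ≡ (- 1ℚ) ^ n * (κ n * κ n)
u-diagonal n = begin
  κ n * (ω n n - ω (suc n) n)
    ≡⟨ cong₂ (λ x y → κ n * (x - y)) (ω-diagonal n) (ω-vanishes (ℕ.n<1+n n)) ⟩
  κ n * ((- 1ℚ) ^ n * κ n - 0ℚ)
    ≡⟨ solve 2 (λ p κ → κ :* (p :* κ :- con 0ℚ) := p :* (κ :* κ)) refl ((- 1ℚ) ^ n) (κ n) ⟩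
  (- 1ℚ) ^ n * (κ n * κ n) ∎

-- Values of B on the orthogonal polynomials

ℋ⁻₁-suc : ∀ n → ι (suc n) * ℋ⁻₁ (suc n) ≡ ι (suc n) * ℋ⁻₁ n + (- 1ℚ) ^ n
ℋ⁻₁-suc n = begin
  ι (suc n) * ℋ⁻₁ (suc n)
    ≡⟨ cong (ι (suc n) *_) (sum-init-last {n} (term ∘ toℕ)) ⟩
  ι (suc n) * (sum {n} (term ∘ toℕ ∘ inject₁) + term (toℕ (fromℕ n)))
    ≡⟨ cong₂ (λ x y → ι (suc n) * (x + y))
         (sum-cong-≗ {n} (λ i → cong term (Fin.toℕ-inject₁ i))) (cong term (Fin.toℕ-fromℕ n)) ⟩
  ι (suc n) * (ℋ⁻₁ n + (- 1ℚ) ^ n * (+ 1 / suc n))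
    ≡⟨ solve 4 (λ m h p q → m :* (h :+ p :* q) := m :* h :+ p :* (m :* q)) refl
         (ι (suc n)) (ℋ⁻₁ n) ((- 1ℚ) ^ n) (+ 1 / suc n) ⟩
  ι (suc n) * ℋ⁻₁ n + (- 1ℚ) ^ n * (ι (suc n) * (+ 1 / suc n))
    ≡⟨ cong (λ x → ι (suc n) * ℋ⁻₁ n + (- 1ℚ) ^ n * x) (ι*1/ (suc n)) ⟩
  ι (suc n) * ℋ⁻₁ n + (- 1ℚ) ^ n * 1ℚ
    ≡⟨ cong (λ z → ι (suc n) * ℋ⁻₁ n + z) (ℚ.*-identityʳ ((- 1ℚ) ^ n)) ⟩
  ι (suc n) * ℋ⁻₁ n + (- 1ℚ) ^ n ∎
  where
  term : ℕ → ℚ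
  term i = (- 1ℚ) ^ i * (+ 1 / suc i)

-- uᵇ n k = B (xᵏ Pₙ), where B (xᵏ) = bₖ.
uᵇ : ℕ → ℕ → ℚ
uᵇ n zero    = - ι 2 * (- 1ℚ) ^ n * κ n * ℋ⁻₁ n
uᵇ n (suc k) = u n k

uᵇ-1 : ∀ k → uᵇ 1 k ≡ uᵇ 0 (suc k) + - ½ * uᵇ 0 k
uᵇ-1 zero    = refl
uᵇ-1 (suc k) = u-1 k

-- At `k = 0` the term B (x Pₙ₊₁) = L (Pₙ₊₁) is zero. Two uses of `ℋ⁻₁-suc` with opposite signs give
-- (n + 2) h₂ = h₁ + (n + 1) h, which is the recurrence up to the factor `- ½ * p * m * κ n`.
uᵇ-2+ : ∀ n k → uᵇ (2 ℕ.+ n) k ≡ uᵇ (suc n) (suc k) + - ½ * uᵇ (suc n) k + γ n * uᵇ n k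
uᵇ-2+ n (suc k) = u-2+ n k
uᵇ-2+ n zero = begin
  - ι 2 * (- 1ℚ * (- 1ℚ * p)) * (½ * m′ * (½ * m * κ n)) * h₂
    ≡⟨ solve 5 (λ m m′ p κ h₂ →
         con (- ι 2) :* (con (- 1ℚ) :* (con (- 1ℚ) :* p)) :* (con ½ :* m′ :* (con ½ :* m :* κ)) :* h₂
         := con (- ½) :* p :* m :* κ :* (m′ :* h₂)) refl m m′ p (κ n) h₂ ⟩
  - ½ * p * m * κ n * (m′ * h₂)
    ≡⟨ cong (- ½ * p * m * κ n *_) (trans (ℋ⁻₁-suc (suc n)) (cong (λ x → x * h₁ + - 1ℚ * p) (ι-suc (suc n)))) ⟩
  - ½ * p * m * κ n * ((1ℚ + m) * h₁ + - 1ℚ * p)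
    ≡⟨ solve 5 (λ m p κ h₁ c → c :* ((con 1ℚ :+ m) :* h₁ :+ con (- 1ℚ) :* p)
         := c :* (h₁ :+ m :* h₁ :+ con (- 1ℚ) :* p)) refl m p (κ n) h₁ (- ½ * p * m * κ n) ⟩
  - ½ * p * m * κ n * (h₁ + m * h₁ + - 1ℚ * p)
    ≡⟨ cong (λ x → - ½ * p * m * κ n * (h₁ + x + - 1ℚ * p)) (ℋ⁻₁-suc n) ⟩
  - ½ * p * m * κ n * (h₁ + (m * h + p) + - 1ℚ * p)
    ≡⟨ solve 5 (λ m p κ h h₁ →
         con (- ½) :* p :* m :* κ :* (h₁ :+ (m :* h :+ p) :+ con (- 1ℚ) :* p)
         := con ½ :* m :* κ :* con 0ℚ :+ con (- ½) :* (con (- ι 2) :* (con (- 1ℚ) :* p) :* (con ½ :* m :* κ) :* h₁)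
            :+ con ½ :* m :* (con ½ :* m) :* (con (- ι 2) :* p :* κ :* h)) refl m p (κ n) h h₁ ⟩
  u (suc n) 0 + - ½ * uᵇ (suc n) 0 + γ n * uᵇ n 0 ∎
  where
  p m m′ h h₁ h₂ : ℚ
  p  = (- 1ℚ) ^ n
  m  = ι (suc n)
  m′ = ι (2 ℕ.+ n)
  h  = ℋ⁻₁ n
  h₁ = ℋ⁻₁ (1 ℕ.+ n)
  h₂ = ℋ⁻₁ (2 ℕ.+ n)

uᵇ₀≡b : ∀ k → b k ≡ uᵇ 0 k
uᵇ₀≡b zero    = refl
uᵇ₀≡b (suc k) = trans (E≡ω⁻ k) (sym (ℚ.*-identityˡ (ω⁻ 0 k)))

-- Evaluation of the two Hankel determinants

norms : ℕ → ℚ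
norms n = product {n} (λ i → u (toℕ i) (toℕ i))

H-E : ∀ n → H n (λ k → E k 1ℚ) ≡ norms n * ((- 1ℚ) ^ n * (κ n * κ n))
H-E n = begin
  H n (λ k → E k 1ℚ)
    -- At a successor index `uᵇ₀≡b` compares `E k 1ℚ` with `u 0 k`.
    ≡⟨ det-cong {suc n} (λ r c → uᵇ₀≡b (suc (toℕ r ℕ.+ toℕ c))) ⟩
  H n (u 0)
    ≡⟨ Hankel-recurrence u (λ _ → - ½) γ u-1 u-2+ n ⟩
  det (columns (suc n) u)
    ≡⟨ det-lowerTriangular (columns (suc n) u) (λ r c → u-vanishes) ⟩
  norms (suc n)
    ≡⟨ product-init-last {n} (λ i → u (toℕ i) (toℕ i)) ⟩
  product {n} (λ i → u (toℕ (inject₁ i)) (toℕ (inject₁ i))) * u (toℕ (fromℕ n)) (toℕ (fromℕ n))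
    ≡⟨ cong₂ _*_ (product-cong {n} λ i → cong (λ j → u j j) (Fin.toℕ-inject₁ i))
         (trans (cong (λ j → u j j) (Fin.toℕ-fromℕ n)) (u-diagonal n)) ⟩
  norms n * ((- 1ℚ) ^ n * (κ n * κ n)) ∎

-- Below its first row the transformed matrix is that of L, so only B (Pₙ) survives from the first
-- row, and the diagonal of its minor consists of the first `n` norms.
H-b : ∀ n → H n b ≡ (- 1ℚ) ^ n * uᵇ n 0 * norms n
H-b n = begin
  H n b
    ≡⟨ det-cong {suc n} (λ r c → uᵇ₀≡b (toℕ r ℕ.+ toℕ c)) ⟩
  H n (uᵇ 0)
    ≡⟨ Hankel-recurrence uᵇ (λ _ → - ½) γ uᵇ-1 uᵇ-2+ n ⟩
  det (columns (suc n) uᵇ)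
    ≡⟨ det-shiftedTriangular (columns (suc n) uᵇ) (λ r c → u-vanishes) ⟩
  (- 1ℚ) ^ n * uᵇ (toℕ (fromℕ n)) 0 * product {n} (λ i → u (toℕ (inject₁ i)) (toℕ i))
    ≡⟨ cong₂ (λ j x → (- 1ℚ) ^ n * uᵇ j 0 * x) (Fin.toℕ-fromℕ n)
         (product-cong {n} λ i → cong (λ j → u j (toℕ i)) (Fin.toℕ-inject₁ i)) ⟩
  (- 1ℚ) ^ n * uᵇ n 0 * norms n ∎

2ⁿ⁺¹/n!*κ : ∀ n → (+ (2 ℕ.^ (n ℕ.+ 1)) /! n) * κ n ≡ ι 2
2ⁿ⁺¹/n!*κ n = trans (cong (_* κ n) (/≡ι* (2 ℕ.^ (n ℕ.+ 1)) (n !) {{n ℕ.!≢0}})) (go n)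
  where
  go : ∀ n → ι (2 ℕ.^ (n ℕ.+ 1)) * (+ 1 /! n) * κ n ≡ ι 2
  go zero    = refl
  go (suc n) = begin
    ι (2 ℕ.* 2 ℕ.^ (n ℕ.+ 1)) * r′ * (½ * ι (suc n) * κ n)
      ≡⟨ cong (λ x → x * r′ * (½ * ι (suc n) * κ n)) (ι-* 2 (2 ℕ.^ (n ℕ.+ 1))) ⟩
    ι 2 * x * r′ * (½ * ι (suc n) * κ n)
      ≡⟨ solve 4 (λ x r m κ → con (ι 2) :* x :* r :* (con ½ :* m :* κ) := x :* (m :* r) :* κ) refl
           x r′ (ι (suc n)) (κ n) ⟩
    x * (ι (suc n) * r′) * κ n
      ≡⟨ cong (λ r → x * r * κ n) (1/!-suc n) ⟩
    x * (+ 1 /! n) * κ n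
      ≡⟨ go n ⟩
    ι 2 ∎
    where
    x r′ : ℚ
    x  = ι (2 ℕ.^ (n ℕ.+ 1))
    r′ = + 1 /! suc n

proposition3p2 : ∀ (n : ℕ) → 1 ℕ.≤ n →
    H n b ≡ (- 1ℚ) ^ (n ∸ 1) * (+ (2 ℕ.^ (n ℕ.+ 1)) /! n) * ℋ⁻₁ n * H n (λ k → E k 1ℚ)
proposition3p2 n@(suc m) _ = begin
  H n b
    ≡⟨ H-b n ⟩
  - 1ℚ * p * (- ι 2 * (- 1ℚ * p) * κ n * ℋ⁻₁ n) * norms n
    -- One of the two factors (-1)ⁿ is kept for L (xⁿ Pₙ); the other combines with the minus of `uᵇ`
    -- to (-1)ⁿ⁻¹.
    ≡⟨ solve 5 (λ p κ h P t → con (- 1ℚ) :* p :* (:- t :* (con (- 1ℚ) :* p) :* κ :* h) :* P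
         := p :* t :* h :* (P :* (con (- 1ℚ) :* p :* κ))) refl p (κ n) (ℋ⁻₁ n) (norms n) (ι 2) ⟩
  p * ι 2 * ℋ⁻₁ n * (norms n * ((- 1ℚ) ^ n * κ n))
    -- Writing 2 as `T * κ n` supplies the second `κ n` that `H-E` requires.
    ≡⟨ cong (λ t → p * t * ℋ⁻₁ n * (norms n * ((- 1ℚ) ^ n * κ n))) (sym (2ⁿ⁺¹/n!*κ n)) ⟩
  p * (T * κ n) * ℋ⁻₁ n * (norms n * ((- 1ℚ) ^ n * κ n))
    ≡⟨ solve 6 (λ p T κ h P s → p :* (T :* κ) :* h :* (P :* (s :* κ))
         := p :* T :* h :* (P :* (s :* (κ :* κ)))) refl p T (κ n) (ℋ⁻₁ n) (norms n) ((- 1ℚ) ^ n) ⟩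
  p * T * ℋ⁻₁ n * (norms n * ((- 1ℚ) ^ n * (κ n * κ n)))
    ≡⟨ cong (p * T * ℋ⁻₁ n *_) (sym (H-E n)) ⟩
  p * T * ℋ⁻₁ n * H n (λ k → E k 1ℚ) ∎
  where
  p T : ℚ
  p = (- 1ℚ) ^ m
  T = + (2 ℕ.^ (n ℕ.+ 1)) /! n
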